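{- $\mathrm{NID}\notin\Sigma_2$.
   Context: Fix a universal prefix-free machine $U$. $K$ denotes prefix-free Kolmogorov complexity and $K(x\mid y)$ conditional prefix-free complexity. For binary strings $x,y$ let $E(x,y)=\max\{K(x\mid y),K(y\mid x)\}$ and $\mathrm{NID}(x,y)=\dfrac{E(x,y)}{\max\{K(x),K(y)\}}$, a rational-valued function on pairs of strings. The oscillation classes for a function $F$ (here with domain pairs of binary strings and values in $\mathbb{Q}$) are defined inductively, where an approximation of $F$ is a computable $f$ with $\lim_{s\to\infty}f(z,s)=F(z)$ for all $z$: $F\in\Sigma_1$ if it has an approximation nondecreasing in $s$; $F\in\Pi_1$ if it has one nonincreasing in $s$; $F\in\Sigma_{n+1}$ if it has a computable approximation $f$ such that for every $z$ there is $s_z$ with $f(z,t)$ nondecreasing for $t<s_z$ and $(f(z,t))_{t\geq s_z}$ behaving as a $\Pi_n$-approximation; $F\in\Pi_{n+1}$ likewise with nonincreasing for $t<s_z$ and $(f(z,t))_{t\geq s_z}$ a $\Sigma_n$-approximation. Thus $\Sigma_n$ (resp. $\Pi_n$) consists of the functions having a computable approximation that changes direction at most $n-1$ times on each input (at most $n$ monotone phases), starting by going up (resp. down). -}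

module Defs where

open import Data.Bool using (Bool; true; false)
open import Data.Nat as ℕ using (ℕ; zero; suc; _+_; _*_; _⊔_; _≤_; _<_; _≥_)
import Data.Nat.Properties as ℕ
open import Data.Integer as ℤ using (ℤ; +_; -[1+_])
open import Data.Rational as ℚ using (ℚ; 0ℚ; ↥_; ↧ₙ_)
open import Data.Fin using (Fin; zero; suc)
open import Data.Vec using (Vec; []; _∷_; lookup)
open import Data.Vec.Relation.Binary.Pointwise.Inductive using (Pointwise; []; _∷_)
open import Data.List using (List; []; _∷_; _++_; length)
open import Data.List.Relation.Binary.Prefix.Heterogeneous using (Prefix; []; _∷_)
open import Data.Product using (∃-syntax; _×_; _,_)
open import Function.Bundles using (_⇔_; Equivalence)
open import Relation.Nullary using (¬_; contradiction)
open import Relation.Binary.PropositionalEquality using (_≡_; refl; sym; trans; subst)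

------------------------------------------------------------------------
-- Partial recursive functions

data Rec : ℕ → Set where
  zer  : ∀ {n} → Rec n
  succ : Rec 1
  proj : ∀ {n} → Fin n → Rec n
  comp : ∀ {m n} → Rec m → Vec (Rec n) m → Rec n
  prec : ∀ {n} → Rec n → Rec (suc (suc n)) → Rec (suc n)
  mini : ∀ {n} → Rec (suc n) → Rec n

infix 4 _[_]⇓_

-- e [ xs ]⇓ v : the function denoted by e is defined at xs, with value v.
data _[_]⇓_ : ∀ {n} → Rec n → Vec ℕ n → ℕ → Set where
  ⇓zer   : ∀ {n} {xs : Vec ℕ n} → zer [ xs ]⇓ 0
  ⇓succ  : ∀ {x} → succ [ x ∷ [] ]⇓ suc x
  ⇓proj  : ∀ {n} {xs : Vec ℕ n} (i : Fin n) → proj i [ xs ]⇓ lookup xs i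
  ⇓comp  : ∀ {m n} {f : Rec m} {gs : Vec (Rec n) m} {xs : Vec ℕ n} {ys : Vec ℕ m} {v} →
           Pointwise (λ g y → g [ xs ]⇓ y) gs ys → f [ ys ]⇓ v → comp f gs [ xs ]⇓ v
  ⇓prec0 : ∀ {n} {g : Rec n} {h : Rec (suc (suc n))} {xs : Vec ℕ n} {v} →
           g [ xs ]⇓ v → prec g h [ 0 ∷ xs ]⇓ v
  ⇓precS : ∀ {n} {g : Rec n} {h : Rec (suc (suc n))} {xs : Vec ℕ n} {k r v} →
           prec g h [ k ∷ xs ]⇓ r → h [ k ∷ r ∷ xs ]⇓ v → prec g h [ suc k ∷ xs ]⇓ v
  ⇓mini  : ∀ {n} {f : Rec (suc n)} {xs : Vec ℕ n} {k} →
           f [ k ∷ xs ]⇓ 0 →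
           (∀ i → i < k → ∃[ v ] f [ i ∷ xs ]⇓ suc v) →
           mini f [ xs ]⇓ k

------------------------------------------------------------------------
-- Codings

Str : Set
Str = List Bool

-- Bijective base-2 numeration, least significant digit first; in particular
-- every natural number is the code of exactly one string.
codeStr : Str → ℕ
codeStr []          = 0
codeStr (false ∷ w) = 1 + 2 * codeStr w
codeStr (true  ∷ w) = 2 + 2 * codeStr w

codeℤ : ℤ → ℕ
codeℤ (+ n)      = 2 * n
codeℤ (-[1+ n ]) = 1 + 2 * n

-- A rational-valued function is computable when its numerator and denominator
-- (in lowest terms) are.
Computable : (Str × Str → ℕ → ℚ) → Set
Computable f =
  ∃[ num ] ∃[ den ] ∀ x y s →
    let args = codeStr x ∷ codeStr y ∷ s ∷ [] in
      (num [ args ]⇓ codeℤ (↥ (f (x , y) s)))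
    × (den [ args ]⇓ ↧ₙ (f (x , y) s))

------------------------------------------------------------------------
-- Oscillation classes

ConvergesTo : (ℕ → ℚ) → ℚ → Set
ConvergesTo a l =
  ∀ ε → 0ℚ ℚ.< ε → ∃[ N ] ∀ s → s ≥ N → ℚ.∣ a s ℚ.- l ∣ ℚ.< ε

NonDecreasing NonIncreasing : (ℕ → ℚ) → Set
NonDecreasing a = ∀ i j → i ≤ j → a i ℚ.≤ a j
NonIncreasing a = ∀ i j → i ≤ j → a j ℚ.≤ a i

NonDecreasingBelow NonIncreasingBelow : ℕ → (ℕ → ℚ) → Set
NonDecreasingBelow s a = ∀ i j → i ≤ j → j < s → a i ℚ.≤ a j
NonIncreasingBelow s a = ∀ i j → i ≤ j → j < s → a j ℚ.≤ a i

-- Behaviour in s of a Σₙ- (resp. Πₙ-) approximation on one fixed input.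
-- The levels start at n = 1: the instances at n = 0 are empty.
data ΣSeq : ℕ → (ℕ → ℚ) → Set
data ΠSeq : ℕ → (ℕ → ℚ) → Set

data ΣSeq where
  Σ-base : ∀ {a} → NonDecreasing a → ΣSeq 1 a
  Σ-step : ∀ {n a} (s : ℕ) → NonDecreasingBelow s a →
           ΠSeq n (λ t → a (s + t)) → ΣSeq (suc n) a

data ΠSeq where
  Π-base : ∀ {a} → NonIncreasing a → ΠSeq 1 a
  Π-step : ∀ {n a} (s : ℕ) → NonIncreasingBelow s a →
           ΣSeq n (λ t → a (s + t)) → ΠSeq (suc n) a

IsApproximation : (Str × Str → ℕ → ℚ) → (Str × Str → ℚ) → Set
IsApproximation f F = Computable f × (∀ z → ConvergesTo (f z) (F z))

infix 4 _∈Σ[_] _∈Π[_] _∉Σ[_]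

_∈Σ[_] _∈Π[_] _∉Σ[_] : (Str × Str → ℚ) → ℕ → Set
F ∈Σ[ n ] = ∃[ f ] IsApproximation f F × (∀ z → ΣSeq n (f z))
F ∈Π[ n ] = ∃[ f ] IsApproximation f F × (∀ z → ΠSeq n (f z))
F ∉Σ[ n ] = ¬ (F ∈Σ[ n ])

------------------------------------------------------------------------
-- Prefix-free machines and complexity

-- Arguments: the program and the condition.
Machine : Set
Machine = Rec 2

infix 4 _⟨_∣_⟩↦_

_⟨_∣_⟩↦_ : Machine → Str → Str → Str → Set
M ⟨ p ∣ y ⟩↦ x = M [ codeStr p ∷ codeStr y ∷ [] ]⇓ codeStr x

PrefixFree : Machine → Set
PrefixFree M = ∀ y p q x x′ →
  M ⟨ p ∣ y ⟩↦ x → M ⟨ q ∣ y ⟩↦ x′ → Prefix _≡_ p q → p ≡ q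

-- Universality by adjunction: U (ρ ++ p ∣ y) ≃ M (p ∣ y) as partial functions.
record IsUniversal (U : Machine) : Set where
  field
    prefixFree : PrefixFree U
    universal  : ∀ M → PrefixFree M →
                 ∃[ ρ ] ∀ p y x → (M ⟨ p ∣ y ⟩↦ x) ⇔ (U ⟨ ρ ++ p ∣ y ⟩↦ x)

-- K x y is K(x ∣ y), the least length of a program for x given y.  It is
-- characterised rather than defined, as this minimum is not computable.
record IsComplexity (U : Machine) (K : Str → Str → ℕ) : Set where
  field
    attained : ∀ x y → ∃[ p ] (U ⟨ p ∣ y ⟩↦ x) × length p ≡ K x y
    minimal  : ∀ x y p → U ⟨ p ∣ y ⟩↦ x → K x y ≤ length p

-- The machine defined exactly at the program "0" (code 1).
private
  isOne : Rec 1
  isOne = prec (comp succ (zer ∷ [])) (proj zero)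

  M₀ : Machine
  M₀ = mini (comp isOne (proj (suc zero) ∷ []))

  isOne-inv : ∀ n → isOne [ n ∷ [] ]⇓ 0 → n ≡ 1
  isOne-inv zero (⇓prec0 (⇓comp _ ()))
  isOne-inv (suc zero) _ = refl
  isOne-inv (suc (suc n)) d = contradiction (lem d refl) λ ()
    where
    lem : ∀ {k v} → isOne [ suc k ∷ [] ]⇓ v → v ≡ 0 → k ≡ 0
    lem (⇓precS _ (⇓proj _)) eq = eq

  code-one : ∀ p → codeStr p ≡ 1 → p ≡ false ∷ []
  code-one (false ∷ []) _ = refl
  code-one (false ∷ false ∷ _) ()
  code-one (false ∷ true ∷ _) ()
  code-one (true ∷ _) ()

  M₀-dom : ∀ {a b v} → M₀ [ a ∷ b ∷ [] ]⇓ v → a ≡ 1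
  M₀-dom (⇓mini (⇓comp (⇓proj _ ∷ []) d) _) = isOne-inv _ d

  M₀-prefixFree : PrefixFree M₀
  M₀-prefixFree _ p q _ _ d d′ _ =
    trans (code-one p (M₀-dom d)) (sym (code-one q (M₀-dom d′)))

  M₀-def : M₀ ⟨ false ∷ [] ∣ [] ⟩↦ []
  M₀-def = ⇓mini (⇓comp (⇓proj _ ∷ [])
             (⇓precS (⇓prec0 (⇓comp (⇓zer ∷ []) ⇓succ)) (⇓proj zero))) λ _ ()

module _ {U : Machine} (univ : IsUniversal U)
         {K : Str → Str → ℕ} (isK : IsComplexity U K) where
  open IsUniversal univ
  open IsComplexity isK

  K≢0 : ∀ x y → ¬ (K x [] ⊔ K y [] ≡ 0)
  K≢0 x y eq with attained x [] | universal M₀ M₀-prefixFree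
  ... | [] , d , _ | ρ , sim = ++≢[] ρ
        (prefixFree [] [] (ρ ++ false ∷ []) x [] d (Equivalence.to (sim (false ∷ []) [] []) M₀-def) [])
    where
    ++≢[] : ∀ ρ → ¬ ([] ≡ ρ ++ false ∷ [])
    ++≢[] []      ()
    ++≢[] (_ ∷ _) ()
  ... | _ ∷ _ , _ , len | _ with ℕ.≤-trans (ℕ.m≤m⊔n (K x []) (K y [])) (ℕ.≤-reflexive eq)
  ... | Kx≤0 with subst (_≤ 0) (sym len) Kx≤0
  ... | ()

  E : Str → Str → ℕ
  E x y = K x y ⊔ K y x

  -- The unconditional complexity K(x) is K(x ∣ ε).
  NID : Str × Str → ℚ
  NID (x , y) = ((+ E x y) ℚ./ (K x [] ⊔ K y [])) {{ℕ.≢-nonZero (K≢0 x y)}}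

{-# OPTIONS --safe #-}

-- A Σ₂-approximation that has once decreased on an input never increases again
-- there, so it suffices to find a pair on which the approximation f must be
-- high, then low, then higher again.  From y one can compute the first
-- x = y² + b with b ≤ y that f at some stage puts at distance at least 1/7
-- from y; one exists for suitable y of arbitrarily high complexity, by counting.
-- As y is computable from x as well, E(x , y) = O(1), so NID(x , y) < 1/n if y
-- is complex enough, and f eventually drops below 1/n.  Hence, given n, one can
-- search for a pair on which f was first at least 1/7 and later below 1/n.  The
-- pair found has complexity O(log n), so its NID exceeds 1/n for large n, and f
-- has to rise again.
module Submission where

open import Defs
open import Data.Bool using (true; false)
open import Data.Empty using (⊥; ⊥-elim)
open import Data.Fin using (Fin; zero; suc; toℕ; fromℕ<)
import Data.Fin.Properties as Fin
open import Data.Integer as ℤ using (+_; -[1+_])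
import Data.Integer.Properties as ℤ
open import Data.List using ([]; _∷_; _++_; length; replicate)
open import Data.List.Properties using (length-++; length-replicate)
open import Data.List.Relation.Binary.Prefix.Heterogeneous using (Prefix; []; _∷_)
open import Data.Nat
open import Data.Nat.Coprimality using (1-coprimeTo)
open import Data.Nat.Properties
open import Data.Nat.Tactic.RingSolver using (solve-∀)
open import Data.Product using (∃-syntax; _×_; _,_; proj₁; proj₂)
open import Data.Rational as ℚ using (ℚ; mkℚ; 0ℚ; ↥_; ↧ₙ_; *≤*; *<*)
import Data.Rational.Properties as ℚ
open import Data.Rational.Unnormalised as ℚᵘ using (mkℚᵘ)
import Data.Rational.Unnormalised.Properties as ℚᵘ
open import Data.Vec using (Vec; []; _∷_; lookup; head; tail)
open import Data.Vec.Relation.Binary.Pointwise.Inductive using (Pointwise; []; _∷_)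
open import Function using (_∘_)
open import Function.Bundles using (Equivalence)
open import Relation.Binary.Definitions using (tri<; tri≈; tri>)
open import Relation.Binary.PropositionalEquality
open import Relation.Nullary using (¬_; yes; no; contradiction)

-- Recursive functions

mutual
  ⇓-deterministic : ∀ {n} {e : Rec n} {xs u v} → e [ xs ]⇓ u → e [ xs ]⇓ v → u ≡ v
  ⇓-deterministic ⇓zer ⇓zer = refl
  ⇓-deterministic ⇓succ ⇓succ = refl
  ⇓-deterministic (⇓proj i) (⇓proj .i) = refl
  ⇓-deterministic (⇓comp ds d) (⇓comp ds′ d′) with refl ← ⇓-deterministic* ds ds′ =
    ⇓-deterministic d d′
  ⇓-deterministic (⇓prec0 d) (⇓prec0 d′) = ⇓-deterministic d d′
  ⇓-deterministic (⇓precS c d) (⇓precS c′ d′) with refl ← ⇓-deterministic c c′ =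
    ⇓-deterministic d d′
  ⇓-deterministic (⇓mini {k = k} d below) (⇓mini {k = l} d′ below′) with <-cmp k l
  ... | tri≈ _ k≡l _ = k≡l
  ... | tri< k<l _ _ = contradiction (⇓-deterministic d (proj₂ (below′ k k<l))) λ ()
  ... | tri> _ _ l<k = contradiction (⇓-deterministic (proj₂ (below l l<k)) d′) λ ()

  ⇓-deterministic* : ∀ {m n} {es : Vec (Rec n) m} {xs us vs} →
    Pointwise (λ e v → e [ xs ]⇓ v) es us → Pointwise (λ e v → e [ xs ]⇓ v) es vs → us ≡ vs
  ⇓-deterministic* [] [] = refl
  ⇓-deterministic* (d ∷ ds) (d′ ∷ ds′) =
    cong₂ _∷_ (⇓-deterministic d d′) (⇓-deterministic* ds ds′)

-- Certifies total functions only; the unbounded searches are bare `Rec` codes whose convergence is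
-- proved input by input.
record Recursive {n} (f : Vec ℕ n → ℕ) : Set where
  constructor _computing_
  field
    code    : Rec n
    correct : ∀ xs → code [ xs ]⇓ f xs
open Recursive

private variable
  n : ℕ
  f g h : Vec ℕ n → ℕ

var : (i : Fin n) → Recursive (λ xs → lookup xs i)
var i = proj i computing λ _ → ⇓proj i

const : ∀ c → Recursive {n} (λ _ → c)
const zero    = zer computing λ _ → ⇓zer
const (suc c) = comp succ (code (const c) ∷ []) computing λ xs → ⇓comp (correct (const c) xs ∷ []) ⇓succ

suc′ : Recursive f → Recursive (λ xs → suc (f xs))
suc′ F = comp succ (code F ∷ []) computing λ xs → ⇓comp (correct F xs ∷ []) ⇓succ

compose₁ : {f : Vec ℕ 1 → ℕ} → Recursive f → Recursive g → Recursive (λ xs → f (g xs ∷ []))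
compose₁ F G = comp (code F) (code G ∷ []) computing λ xs → ⇓comp (correct G xs ∷ []) (correct F _)

compose₂ : {f : Vec ℕ 2 → ℕ} → Recursive f → Recursive g → Recursive h →
           Recursive (λ xs → f (g xs ∷ h xs ∷ []))
compose₂ F G H = comp (code F) (code G ∷ code H ∷ []) computing
  λ xs → ⇓comp (correct G xs ∷ correct H xs ∷ []) (correct F _)

compose₃ : {f : Vec ℕ 3 → ℕ} {i : Vec ℕ n → ℕ} →
           Recursive f → Recursive g → Recursive h → Recursive i →
           Recursive (λ xs → f (g xs ∷ h xs ∷ i xs ∷ []))
compose₃ F G H I = comp (code F) (code G ∷ code H ∷ code I ∷ []) computing
  λ xs → ⇓comp (correct G xs ∷ correct H xs ∷ correct I xs ∷ []) (correct F _)

-- Here `g` is an existing function that has to satisfy the recursion equation, so ordinary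
-- arithmetic is certified without being redefined.
primitiveRecursion : ∀ {g : ℕ → Vec ℕ n → ℕ} {h} →
  Recursive (g 0) → Recursive h → (∀ k xs → g (suc k) xs ≡ h (k ∷ g k xs ∷ xs)) →
  Recursive (λ xs → g (head xs) (tail xs))
primitiveRecursion {g = g} G H step =
  prec (code G) (code H) computing λ { (k ∷ xs) → run k xs }
  where
  run : ∀ k xs → prec (code G) (code H) [ k ∷ xs ]⇓ g k xs
  run zero    xs = ⇓prec0 (correct G xs)
  run (suc k) xs = ⇓precS (run k xs) (subst (code H [ _ ]⇓_) (sym (step k xs)) (correct H _))

infixl 6 _⊕_ _⊖_
infixl 7 _⊗_

_⊕_ : Recursive f → Recursive g → Recursive (λ xs → f xs + g xs)
_⊕_ = compose₂ (primitiveRecursion {g = λ k xs → k + lookup xs zero}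
  (var zero) (suc′ (var (suc zero))) λ _ _ → refl)

_⊗_ : Recursive f → Recursive g → Recursive (λ xs → f xs * g xs)
_⊗_ = compose₂ (primitiveRecursion {g = λ k xs → k * lookup xs zero}
  (const 0) (var (suc (suc zero)) ⊕ var (suc zero)) λ _ _ → refl)

_⊖_ : Recursive f → Recursive g → Recursive (λ xs → f xs ∸ g xs)
-- The recursion runs on the subtrahend, hence the swapped arguments `G F`.
F ⊖ G = compose₂ (primitiveRecursion {g = λ k xs → lookup xs zero ∸ k}
  (var zero) (compose₁ pred′ (var (suc zero)))
  λ { k (x ∷ []) → sym (pred[m∸n]≡m∸[1+n] x k) }) G F
  where
  pred′ : Recursive {1} (λ xs → pred (head xs))
  pred′ = primitiveRecursion {g = λ k _ → pred k} (const 0) (var zero) λ _ _ → refl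

-- The conclusion has the shape of the two premises of `⇓mini`. The known zero `w` drives the
-- induction, each step shifting `p` by one.
least : (p : ℕ → ℕ) → ∀ w → p w ≡ 0 → ∃[ k ] p k ≡ 0 × (∀ i → i < k → ∃[ v ] p i ≡ suc v)
least p w pw≡0 with p 0 in p0≡
... | zero = 0 , p0≡ , λ _ ()
least p zero    pw≡0 | suc v = contradiction (trans (sym p0≡) pw≡0) λ ()
least p (suc w) pw≡0 | suc v with least (p ∘ suc) w pw≡0
... | k , pk≡0 , below = suc k , pk≡0 , λ where
  zero    _         → v , p0≡
  (suc i) (s≤s i<k) → below i i<k

minimise : {f : Vec ℕ (suc n) → ℕ} (F : Recursive f) → ∀ xs w → f (w ∷ xs) ≡ 0 →
           ∃[ k ] f (k ∷ xs) ≡ 0 × mini (code F) [ xs ]⇓ k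
minimise {f = f} F xs w fw≡0 with least (λ k → f (k ∷ xs)) w fw≡0
... | k , fk≡0 , below = k , fk≡0 , ⇓mini
  (subst (code F [ k ∷ xs ]⇓_) fk≡0 (correct F _))
  λ i i<k → let v , fi≡1+v = below i i<k in v , subst (code F [ i ∷ xs ]⇓_) fi≡1+v (correct F _)

search : {f g : Vec ℕ 3 → ℕ} → Recursive f → Recursive g → Rec 2
search test out = comp (code out) (mini (code test) ∷ proj zero ∷ proj (suc zero) ∷ [])

search⇓ : {f g : Vec ℕ 3 → ℕ} (F : Recursive f) (G : Recursive g) → ∀ a b w →
  f (w ∷ a ∷ b ∷ []) ≡ 0 →
  ∃[ k ] f (k ∷ a ∷ b ∷ []) ≡ 0 × search F G [ a ∷ b ∷ [] ]⇓ g (k ∷ a ∷ b ∷ [])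
search⇓ F G a b w fw≡0 with minimise F (a ∷ b ∷ []) w fw≡0
... | k , fk≡0 , d = k , fk≡0 , ⇓comp (d ∷ ⇓proj _ ∷ ⇓proj _ ∷ []) (correct G _)

-- Parity, integer square roots, pairing and powers of two

mod2 : ℕ → ℕ
mod2 zero    = 0
mod2 (suc k) = 1 ∸ mod2 k

mod2ᵣ : Recursive f → Recursive (λ xs → mod2 (f xs))
mod2ᵣ = compose₁ (primitiveRecursion {g = λ k _ → mod2 k}
  (const 0) (const 1 ⊖ var (suc zero)) λ _ _ → refl)

mod2-even : ∀ m → mod2 (2 * m) ≡ 0
mod2-even zero    = refl
mod2-even (suc m) rewrite +-suc m (m + 0) | mod2-even m = refl

mod2-odd : ∀ m → mod2 (1 + 2 * m) ≡ 1
mod2-odd m rewrite mod2-even m = refl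

-- `1 ∸ (m ∸ n)` serves as the indicator of `m ≤ n`, turning the case distinctions in `root` and
-- `leadingPower` into arithmetic.
1∸[m∸n]≡1 : ∀ {m n} → m ≤ n → 1 ∸ (m ∸ n) ≡ 1
1∸[m∸n]≡1 m≤n = cong (1 ∸_) (m≤n⇒m∸n≡0 m≤n)

1∸[m∸n]≡0 : ∀ {m n} → n < m → 1 ∸ (m ∸ n) ≡ 0
1∸[m∸n]≡0 n<m = m≤n⇒m∸n≡0 (m<n⇒0<n∸m n<m)

-- The integer square root: the second summand is 1 exactly when the next square has been reached.
root : ℕ → ℕ
root zero    = 0
root (suc k) = root k + (1 ∸ ((1 + root k) * (1 + root k) ∸ suc k))

rootᵣ : Recursive f → Recursive (λ xs → root (f xs))
rootᵣ = compose₁ (primitiveRecursion {g = λ k _ → root k} (const 0)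
  (r ⊕ (const 1 ⊖ (suc′ r ⊗ suc′ r ⊖ suc′ (var zero)))) λ _ _ → refl)
  where
  r : Recursive {2} _
  r = var (suc zero)

root-bounds : ∀ n → root n * root n ≤ n × n < (1 + root n) * (1 + root n)
root-bounds zero = z≤n , s≤s z≤n
root-bounds (suc k) with root k | root-bounds k
... | r | r²≤k , k<[1+r]² with (1 + r) * (1 + r) ≤? suc k
... | yes [1+r]²≤1+k rewrite 1∸[m∸n]≡1 [1+r]²≤1+k | +-comm r 1 =
  [1+r]²≤1+k , ≤-<-trans k<[1+r]² (*-mono-< (n<1+n (1 + r)) (n<1+n (1 + r)))
... | no [1+r]²≰1+k rewrite 1∸[m∸n]≡0 (≰⇒> [1+r]²≰1+k) | +-identityʳ r =
  m≤n⇒m≤1+n r²≤k , ≰⇒> [1+r]²≰1+k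

m²<n²⇒m<n : ∀ {m n} → m * m < n * n → m < n
m²<n²⇒m<n {m} {n} m²<n² = ≰⇒> λ n≤m → <⇒≱ m²<n² (*-mono-≤ n≤m n≤m)

-- For b ≤ a the number a² + b lies below (1 + a)². This decodes `pair`, and later recovers y from
-- its partner y² + b.
root-unique : ∀ a {b} → b ≤ a → root (a * a + b) ≡ a
root-unique a {b} b≤a with root-bounds (a * a + b)
... | lower , upper = ≤-antisym
  (s≤s⁻¹ (m²<n²⇒m<n (≤-<-trans lower a²+b<[1+a]²)))
  (s≤s⁻¹ (m²<n²⇒m<n (≤-<-trans (m≤m+n (a * a) b) upper)))
  where
  a²+b<[1+a]² : a * a + b < (1 + a) * (1 + a)
  a²+b<[1+a]² = begin-strict
    a * a + b           ≤⟨ +-monoʳ-≤ (a * a) b≤a ⟩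
    a * a + a           ≤⟨ m≤m+n _ a ⟩
    a * a + a + a       <⟨ n<1+n _ ⟩
    1 + (a * a + a + a) ≡⟨ square a ⟨
    (1 + a) * (1 + a)   ∎
    where
    open ≤-Reasoning
    square : ∀ a → (1 + a) * (1 + a) ≡ 1 + (a * a + a + a)
    square = solve-∀

-- The offset a from the square (a + b)² is at most a + b, so the root returns a + b and the
-- remainder is a.
pair : ℕ → ℕ → ℕ
pair a b = (a + b) * (a + b) + a

fst snd : ℕ → ℕ
fst w = w ∸ root w * root w
snd w = root w ∸ fst w

fst-pair : ∀ a b → fst (pair a b) ≡ a
fst-pair a b rewrite root-unique (a + b) (m≤m+n a b) = m+n∸m≡n ((a + b) * (a + b)) a

snd-pair : ∀ a b → snd (pair a b) ≡ b
snd-pair a b rewrite fst-pair a b | root-unique (a + b) (m≤m+n a b) = m+n∸m≡n a b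

fstᵣ : Recursive f → Recursive (λ xs → fst (f xs))
fstᵣ F = F ⊖ rootᵣ F ⊗ rootᵣ F

sndᵣ : Recursive f → Recursive (λ xs → snd (f xs))
sndᵣ F = rootᵣ F ⊖ fstᵣ F

-- The largest power of two that is at most 1 + n. On the code of a string w it is `2 ^ length w`,
-- because the strings of length l have the codes from 2 ^ l - 1 to 2 ^ (l + 1) - 2.
leadingPower : ℕ → ℕ
leadingPower zero    = 1
leadingPower (suc k) =
  leadingPower k + leadingPower k * (1 ∸ (2 * leadingPower k ∸ (2 + k)))

leadingPowerᵣ : Recursive f → Recursive (λ xs → leadingPower (f xs))
leadingPowerᵣ = compose₁ (primitiveRecursion {g = λ k _ → leadingPower k} (const 1)
  (l ⊕ l ⊗ (const 1 ⊖ (const 2 ⊗ l ⊖ (const 2 ⊕ var zero)))) λ _ _ → refl)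
  where
  l : Recursive {2} _
  l = var (suc zero)

leadingPower-spec : ∀ n → ∃[ j ] leadingPower n ≡ 2 ^ j × 2 ^ j ≤ 1 + n × 1 + n < 2 ^ suc j
leadingPower-spec zero = 0 , refl , s≤s z≤n , s≤s (s≤s z≤n)
leadingPower-spec (suc k) with leadingPower k | leadingPower-spec k
... | l | j , refl , lower , upper with 2 ^ suc j ≤? 2 + k
... | yes 2l≤2+k rewrite 1∸[m∸n]≡1 2l≤2+k =
  suc j , cong (λ l → 2 ^ j + l) (trans (*-identityʳ _) (sym (+-identityʳ _))) , 2l≤2+k ,
  ≤-<-trans upper (^-monoʳ-< 2 (s≤s (s≤s z≤n)) (n<1+n (suc j)))
... | no 2l≰2+k rewrite 1∸[m∸n]≡0 (≰⇒> 2l≰2+k) =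
  j , trans (cong (λ l → 2 ^ j + l) (*-zeroʳ (2 ^ j))) (+-identityʳ _) , m≤n⇒m≤1+n lower , ≰⇒> 2l≰2+k

2^-cancel-< : ∀ i j → 2 ^ i < 2 ^ j → i < j
2^-cancel-< i j lt = ≰⇒> λ j≤i → <⇒≱ lt (^-monoʳ-≤ 2 j≤i)

leadingPower-unique : ∀ {n} j → 2 ^ j ≤ 1 + n → 1 + n < 2 ^ suc j → leadingPower n ≡ 2 ^ j
leadingPower-unique {n} j lower upper with leadingPower-spec n
... | i , eq , lower′ , upper′ = trans eq (cong (2 ^_) (≤-antisym
  (s≤s⁻¹ (2^-cancel-< i (suc j) (≤-<-trans lower′ upper))) (s≤s⁻¹ (2^-cancel-< j (suc i) (≤-<-trans lower upper′)))))

-- Strings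

-- The successor in bijective base 2, with carry; iterating it inverts `codeStr`.
bump : Str → Str
bump []          = false ∷ []
bump (false ∷ w) = true ∷ w
bump (true ∷ w)  = false ∷ bump w

codeStr-bump : ∀ w → codeStr (bump w) ≡ suc (codeStr w)
codeStr-bump []          = refl
codeStr-bump (false ∷ w) = refl
codeStr-bump (true ∷ w) rewrite codeStr-bump w = cong suc (*-suc 2 (codeStr w))

decode : ℕ → Str
decode zero    = []
decode (suc n) = bump (decode n)

codeStr-decode : ∀ n → codeStr (decode n) ≡ n
codeStr-decode zero    = refl
codeStr-decode (suc n) = trans (codeStr-bump (decode n)) (cong suc (codeStr-decode n))

codeStr-injective : ∀ v w → codeStr v ≡ codeStr w → v ≡ w
codeStr-injective []          []          _ = refl
codeStr-injective []          (false ∷ w) ()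
codeStr-injective []          (true ∷ w)  ()
codeStr-injective (false ∷ v) []          ()
codeStr-injective (true ∷ v)  []          ()
codeStr-injective (false ∷ v) (false ∷ w) eq =
  cong (false ∷_) (codeStr-injective v w (*-cancelˡ-≡ _ _ 2 (suc-injective eq)))
codeStr-injective (true ∷ v)  (true ∷ w)  eq =
  cong (true ∷_) (codeStr-injective v w (*-cancelˡ-≡ _ _ 2 (suc-injective (suc-injective eq))))
codeStr-injective (false ∷ v) (true ∷ w)  eq =
  ⊥-elim (even≢odd (codeStr v) (codeStr w) (suc-injective eq))
codeStr-injective (true ∷ v)  (false ∷ w) eq =
  ⊥-elim (even≢odd (codeStr w) (codeStr v) (sym (suc-injective eq)))

2^length≤1+codeStr : ∀ w → 2 ^ length w ≤ 1 + codeStr w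
2^length≤1+codeStr []          = s≤s z≤n
2^length≤1+codeStr (false ∷ w) =
  ≤-trans (*-monoʳ-≤ 2 (2^length≤1+codeStr w)) (≤-reflexive (*-suc 2 (codeStr w)))
2^length≤1+codeStr (true ∷ w)  =
  m≤n⇒m≤1+n (≤-trans (*-monoʳ-≤ 2 (2^length≤1+codeStr w)) (≤-reflexive (*-suc 2 (codeStr w))))

1+codeStr<2^[1+length] : ∀ w → 1 + codeStr w < 2 ^ suc (length w)
1+codeStr<2^[1+length] []          = s≤s (s≤s z≤n)
1+codeStr<2^[1+length] (b ∷ w)     = digit b
  where
  arith : ∀ c → 2 * (2 + c) ≡ 4 + 2 * c
  arith = solve-∀
  bound : 4 + 2 * codeStr w ≤ 2 ^ (2 + length w)
  bound = subst (_≤ 2 ^ (2 + length w)) (arith (codeStr w))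
    (*-monoʳ-≤ 2 (1+codeStr<2^[1+length] w))
  digit : ∀ b → 1 + codeStr (b ∷ w) < 2 ^ (2 + length w)
  digit false = <⇒≤ bound
  digit true  = bound

length≤ : ∀ {n} j → 1 + n < 2 ^ suc j → length (decode n) ≤ j
length≤ {n} j 1+n<2^[1+j] = s≤s⁻¹ (2^-cancel-< (length (decode n)) (suc j) (≤-<-trans
  (subst (λ k → 2 ^ length (decode n) ≤ 1 + k) (codeStr-decode n) (2^length≤1+codeStr (decode n)))
  1+n<2^[1+j]))

-- Self-delimiting programs

selfDelimit : Str → Str
selfDelimit w = replicate (length w) true ++ false ∷ w

length-selfDelimit : ∀ w → length (selfDelimit w) ≡ 2 * length w + 1
length-selfDelimit w = begin
  length (selfDelimit w)                              ≡⟨ length-++ (replicate (length w) true) ⟩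
  length (replicate (length w) true) + suc (length w) ≡⟨ cong (_+ suc (length w)) (length-replicate (length w)) ⟩
  length w + suc (length w)                           ≡⟨ arith (length w) ⟩
  2 * length w + 1                                    ∎
  where
  open ≡-Reasoning
  arith : ∀ l → l + suc l ≡ 2 * l + 1
  arith = solve-∀

Prefix-length≡ : ∀ {v w : Str} → length v ≡ length w → Prefix _≡_ v w → v ≡ w
Prefix-length≡ {w = []}    _  []           = refl
Prefix-length≡ {w = _ ∷ _} () []
Prefix-length≡             eq (refl ∷ v≼w) = cong (_ ∷_) (Prefix-length≡ (suc-injective eq) v≼w)

unary-Prefix : ∀ k l {v w} → Prefix _≡_ (replicate k true ++ false ∷ v) (replicate l true ++ false ∷ w) →
               k ≡ l × Prefix _≡_ v w
unary-Prefix zero    zero    (_ ∷ v≼w) = refl , v≼w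
unary-Prefix zero    (suc l) (() ∷ _)
unary-Prefix (suc k) zero    (() ∷ _)
unary-Prefix (suc k) (suc l) (_ ∷ pre) with unary-Prefix k l pre
... | k≡l , v≼w = cong suc k≡l , v≼w

-- The header spells the length in unary, so a prefix relation forces equal lengths and then
-- equality.
selfDelimit-prefixFree : ∀ v w → Prefix _≡_ (selfDelimit v) (selfDelimit w) → v ≡ w
selfDelimit-prefixFree v w pre with unary-Prefix (length v) (length w) pre
... | |v|≡|w| , v≼w = Prefix-length≡ |v|≡|w| v≼w

-- Prepending true doubles codeStr + 2.
codeStr-unary : ∀ k w → codeStr (replicate k true ++ false ∷ w) + 2 ≡ 2 ^ k * (3 + 2 * codeStr w)
codeStr-unary zero    w = arith (codeStr w)
  where
  arith : ∀ c → 1 + 2 * c + 2 ≡ 1 * (3 + 2 * c)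
  arith = solve-∀
codeStr-unary (suc k) w = begin
  2 + 2 * c + 2                   ≡⟨ arith c ⟩
  2 * (c + 2)                     ≡⟨ cong (2 *_) (codeStr-unary k w) ⟩
  2 * (2 ^ k * (3 + 2 * codeStr w)) ≡⟨ *-assoc 2 (2 ^ k) _ ⟨
  2 ^ suc k * (3 + 2 * codeStr w) ∎
  where
  open ≡-Reasoning
  c = codeStr (replicate k true ++ false ∷ w)
  arith : ∀ c → 2 + 2 * c + 2 ≡ 2 * (c + 2)
  arith = solve-∀

-- The action of `selfDelimit` on codes, read off from `codeStr-unary` with `leadingPower n` in
-- place of `2 ^ length w`.
selfDelimitℕ : ℕ → ℕ
selfDelimitℕ n = leadingPower n * (3 + 2 * n) ∸ 2

selfDelimitℕᵣ : Recursive f → Recursive (λ xs → selfDelimitℕ (f xs))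
selfDelimitℕᵣ F = leadingPowerᵣ F ⊗ (const 3 ⊕ const 2 ⊗ F) ⊖ const 2

codeStr-selfDelimit : ∀ w → codeStr (selfDelimit w) ≡ selfDelimitℕ (codeStr w)
codeStr-selfDelimit w = begin
  codeStr (selfDelimit w)                         ≡⟨ m+n∸n≡m _ 2 ⟨
  codeStr (selfDelimit w) + 2 ∸ 2                 ≡⟨ cong (_∸ 2) (codeStr-unary (length w) w) ⟩
  2 ^ length w * (3 + 2 * codeStr w) ∸ 2          ≡⟨ cong (λ l → l * (3 + 2 * codeStr w) ∸ 2)
      (leadingPower-unique (length w) (2^length≤1+codeStr w) (1+codeStr<2^[1+length] w)) ⟨
  selfDelimitℕ (codeStr w)                        ∎
  where open ≡-Reasoning

selfDelimitℕ-decode : ∀ k p → selfDelimitℕ k ≡ codeStr p → p ≡ selfDelimit (decode k)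
selfDelimitℕ-decode k p eq = codeStr-injective _ _ (begin
  codeStr p                         ≡⟨ eq ⟨
  selfDelimitℕ k                    ≡⟨ cong selfDelimitℕ (codeStr-decode k) ⟨
  selfDelimitℕ (codeStr (decode k)) ≡⟨ codeStr-selfDelimit (decode k) ⟨
  codeStr (selfDelimit (decode k))  ∎)
  where open ≡-Reasoning

-- Vanishes exactly on equal arguments, which lets `mini` search for the solution of an equation.
distance : ℕ → ℕ → ℕ
distance a b = (a ∸ b) + (b ∸ a)

distance-refl : ∀ a → distance a a ≡ 0
distance-refl a = cong₂ _+_ (n∸n≡0 a) (n∸n≡0 a)

distance≡0⇒≡ : ∀ a b → distance a b ≡ 0 → a ≡ b
distance≡0⇒≡ a b eq = ≤-antisym
  (m∸n≡0⇒m≤n (m+n≡0⇒m≡0 (a ∸ b) eq))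
  (m∸n≡0⇒m≤n (m+n≡0⇒n≡0 (a ∸ b) eq))

encodes : Recursive {3} (λ xs → distance (selfDelimitℕ (lookup xs zero)) (lookup xs (suc zero)))
encodes = (selfDelimitℕᵣ w ⊖ p) ⊕ (p ⊖ selfDelimitℕᵣ w)
  where
  w = var zero
  p = var (suc zero)

-- The search for a string that the program encodes diverges unless the program is self-delimited;
-- this turns any `e` into a prefix-free machine.
onSelfDelimited : Rec 2 → Machine
onSelfDelimited e = comp e (mini (code encodes) ∷ proj (suc zero) ∷ [])

onSelfDelimited-dom : ∀ e p b {v} → onSelfDelimited e [ codeStr p ∷ b ∷ [] ]⇓ v →
                      ∃[ w ] p ≡ selfDelimit w
onSelfDelimited-dom e p b (⇓comp (⇓mini {k = k} d _ ∷ _) _) = decode k ,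
  selfDelimitℕ-decode k p (distance≡0⇒≡ (selfDelimitℕ k) (codeStr p) (⇓-deterministic (correct encodes _) d))

onSelfDelimited-prefixFree : ∀ e → PrefixFree (onSelfDelimited e)
onSelfDelimited-prefixFree e y p q _ _ d d′ p≼q
  with onSelfDelimited-dom e p _ d | onSelfDelimited-dom e q _ d′
... | v , refl | w , refl = cong selfDelimit (selfDelimit-prefixFree v w p≼q)

Prefix-refl : ∀ (w : Str) → Prefix _≡_ w w
Prefix-refl []      = []
Prefix-refl (_ ∷ w) = refl ∷ Prefix-refl w

onSelfDelimited⇓ : ∀ e w b {v} → e [ codeStr w ∷ b ∷ [] ]⇓ v →
                   onSelfDelimited e [ codeStr (selfDelimit w) ∷ b ∷ [] ]⇓ v
onSelfDelimited⇓ e w b d =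
  let k , eq , search = minimise encodes (codeStr (selfDelimit w) ∷ b ∷ []) (codeStr w) w-encodes
  in ⇓comp (subst (mini (code encodes) [ codeStr (selfDelimit w) ∷ b ∷ [] ]⇓_) (unique k eq) search
            ∷ ⇓proj (suc zero) ∷ []) d
  where
  w-encodes : distance (selfDelimitℕ (codeStr w)) (codeStr (selfDelimit w)) ≡ 0
  w-encodes = subst (λ p → distance (selfDelimitℕ (codeStr w)) p ≡ 0) (sym (codeStr-selfDelimit w))
    (distance-refl (selfDelimitℕ (codeStr w)))

  unique : ∀ k → distance (selfDelimitℕ k) (codeStr (selfDelimit w)) ≡ 0 → k ≡ codeStr w
  unique k eq = begin
    k                  ≡⟨ codeStr-decode k ⟨
    -- Applied to a reflexive prefix, prefix-freeness yields the injectivity of `selfDelimit`.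
    codeStr (decode k) ≡⟨ cong codeStr (selfDelimit-prefixFree w (decode k)
                            (subst (Prefix _≡_ (selfDelimit w)) w≡k (Prefix-refl (selfDelimit w)))) ⟨
    codeStr w          ∎
    where
    open ≡-Reasoning
    w≡k : selfDelimit w ≡ selfDelimit (decode k)
    w≡k = selfDelimitℕ-decode k (selfDelimit w)
      (distance≡0⇒≡ (selfDelimitℕ k) (codeStr (selfDelimit w)) eq)

-- Rationals

-- Shifted by one: this is 1 / (k + 1), so `reciprocal 6` is the threshold 1/7.
reciprocal : ℕ → ℚ
reciprocal k = mkℚ (+ 1) k (1-coprimeTo (suc k))

cross-≤⁺ : ∀ {a b c d} → a * b ≤ c * d → + a ℤ.* + b ℤ.≤ + c ℤ.* + d
cross-≤⁺ {a} {b} {c} {d} le = subst₂ ℤ._≤_ (ℤ.pos-* a b) (ℤ.pos-* c d) (ℤ.+≤+ le)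

cross-≤⁻ : ∀ {a b c d} → + a ℤ.* + b ℤ.≤ + c ℤ.* + d → a * b ≤ c * d
cross-≤⁻ {a} {b} {c} {d} le =
  ℤ.drop‿+≤+ (subst₂ ℤ._≤_ (sym (ℤ.pos-* a b)) (sym (ℤ.pos-* c d)) le)

cross-<⁺ : ∀ {a b c d} → a * b < c * d → + a ℤ.* + b ℤ.< + c ℤ.* + d
cross-<⁺ {a} {b} {c} {d} le = subst₂ ℤ._<_ (ℤ.pos-* a b) (ℤ.pos-* c d) (ℤ.+<+ le)

cross-<⁻ : ∀ {a b c d} → + a ℤ.* + b ℤ.< + c ℤ.* + d → a * b < c * d
cross-<⁻ {a} {b} {c} {d} le =
  ℤ.drop‿+<+ (subst₂ ℤ._<_ (sym (ℤ.pos-* a b)) (sym (ℤ.pos-* c d)) le)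

reciprocal<fraction : ∀ k e m .{{_ : NonZero m}} → m < e * suc k → reciprocal k ℚ.< + e ℚ./ m
reciprocal<fraction k e (suc m) lt = ℚ.toℚᵘ-cancel-< (ℚᵘ.<-respʳ-≃
  (ℚᵘ.≃-sym (ℚ.toℚᵘ-fromℚᵘ (mkℚᵘ (+ e) m)))
  (ℚᵘ.*<* (cross-<⁺ {1} {suc m} {e} {suc k} (subst (_< e * suc k) (sym (*-identityˡ (suc m))) lt))))

fraction<reciprocal : ∀ k e m .{{_ : NonZero m}} → e * suc k < m → + e ℚ./ m ℚ.< reciprocal k
fraction<reciprocal k e (suc m) lt = ℚ.toℚᵘ-cancel-< (ℚᵘ.<-respˡ-≃
  (ℚᵘ.≃-sym (ℚ.toℚᵘ-fromℚᵘ (mkℚᵘ (+ e) m)))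
  (ℚᵘ.*<* (cross-<⁺ {e} {suc k} {1} (subst (e * suc k <_) (sym (*-identityˡ (suc m))) lt))))

reciprocal-antitone : ∀ {k l} → l ≤ k → reciprocal k ℚ.≤ reciprocal l
reciprocal-antitone {k} {l} l≤k = *≤* (cross-≤⁺ {1} {suc l} {1} {suc k} (*-monoʳ-≤ 1 (s≤s l≤k)))

0<reciprocal : ∀ k → 0ℚ ℚ.< reciprocal k
0<reciprocal k = *<* (ℤ.+<+ (s≤s z≤n))

n*2m≡2*mn : ∀ n m → n * (2 * m) ≡ 2 * (m * n)
n*2m≡2*mn = solve-∀

-- 0 iff the rational with numerator code c and denominator d is at least 1/7:
-- codeℤ doubles natural numbers, and sends negative ones to odd codes.
highTest : ℕ → ℕ → ℕ
highTest c d = mod2 c + (2 * d ∸ 7 * c)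

-- 0 if the rational with numerator code c and denominator d is below 1/n; the
-- converse holds for nonnegative rationals.
lowTest : ℕ → ℕ → ℕ → ℕ
lowTest n c d = suc (n * c) ∸ 2 * d

highTestᵣ : ∀ {n} {c d : Vec ℕ n → ℕ} → Recursive c → Recursive d →
            Recursive (λ xs → highTest (c xs) (d xs))
highTestᵣ C D = mod2ᵣ C ⊕ (const 2 ⊗ D ⊖ const 7 ⊗ C)

lowTestᵣ : ∀ {n} {k c d : Vec ℕ n → ℕ} → Recursive k → Recursive c → Recursive d →
           Recursive (λ xs → lowTest (k xs) (c xs) (d xs))
lowTestᵣ K C D = suc′ (K ⊗ C) ⊖ const 2 ⊗ D

highTest-sound : ∀ q → highTest (codeℤ (↥ q)) (↧ₙ q) ≡ 0 → reciprocal 6 ℚ.≤ q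
highTest-sound (mkℚ (+ m) d _) eq = *≤* (cross-≤⁺ {1} {suc d} {m} {7} (begin
  1 * suc d   ≡⟨ *-identityˡ (suc d) ⟩
  suc d       ≤⟨ *-cancelˡ-≤ 2 (subst (2 * suc d ≤_) (n*2m≡2*mn 7 m)
                   (m∸n≡0⇒m≤n (m+n≡0⇒n≡0 (mod2 (2 * m)) eq))) ⟩
  m * 7       ∎))
  where open ≤-Reasoning
highTest-sound (mkℚ -[1+ m ] d _) eq =
  contradiction (trans (sym (mod2-odd m)) (m+n≡0⇒m≡0 (mod2 (1 + 2 * m)) eq)) λ ()

highTest-complete : ∀ q → reciprocal 6 ℚ.≤ q → highTest (codeℤ (↥ q)) (↧ₙ q) ≡ 0
highTest-complete (mkℚ (+ m) d _) (*≤* le) = cong₂ _+_ (mod2-even m) (m≤n⇒m∸n≡0 (begin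
  2 * suc d     ≡⟨ cong (2 *_) (*-identityˡ (suc d)) ⟨
  2 * (1 * suc d) ≤⟨ *-monoʳ-≤ 2 (cross-≤⁻ {1} {suc d} {m} {7} le) ⟩
  2 * (m * 7)   ≡⟨ n*2m≡2*mn 7 m ⟨
  7 * (2 * m)   ∎))
  where open ≤-Reasoning
highTest-complete (mkℚ -[1+ m ] d _) (*≤* ())

lowTest-sound : ∀ k q → lowTest (suc k) (codeℤ (↥ q)) (↧ₙ q) ≡ 0 → q ℚ.< reciprocal k
lowTest-sound k (mkℚ (+ m) d _) eq = *<* (cross-<⁺ {m} {suc k} {1} {suc d} (begin-strict
  m * suc k <⟨ *-cancelˡ-< 2 _ _ (subst (_< 2 * suc d) (n*2m≡2*mn (suc k) m) (m∸n≡0⇒m≤n eq)) ⟩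
  suc d     ≡⟨ *-identityˡ (suc d) ⟨
  1 * suc d ∎))
  where open ≤-Reasoning
lowTest-sound k (mkℚ -[1+ m ] d _) eq = *<* ℤ.-<+

lowTest-complete : ∀ k q → 0ℚ ℚ.< q → q ℚ.< reciprocal k → lowTest (suc k) (codeℤ (↥ q)) (↧ₙ q) ≡ 0
lowTest-complete k (mkℚ (+ m) d _) _ (*<* lt) = m≤n⇒m∸n≡0 (begin-strict
  suc k * (2 * m) ≡⟨ n*2m≡2*mn (suc k) m ⟩
  2 * (m * suc k) <⟨ *-monoʳ-< 2 (cross-<⁻ {m} {suc k} {1} {suc d} lt) ⟩
  2 * (1 * suc d) ≡⟨ cong (2 *_) (*-identityˡ (suc d)) ⟩
  2 * suc d       ∎)
  where open ≤-Reasoning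
lowTest-complete k (mkℚ -[1+ m ] d _) (*<* ()) _

-- Convergence

p<q⇒0<q-p : ∀ {p q} → p ℚ.< q → 0ℚ ℚ.< q ℚ.- p
p<q⇒0<q-p {p} {q} p<q =
  subst (ℚ._< q ℚ.- p) (ℚ.+-inverseʳ p) (ℚ.+-monoˡ-< (ℚ.- p) p<q)

p≤∣p∣ : ∀ p → p ℚ.≤ ℚ.∣ p ∣
p≤∣p∣ (mkℚ (+ _) _ _)    = ℚ.≤-refl
p≤∣p∣ (mkℚ -[1+ _ ] _ _) = *≤* ℤ.-≤+

-- With ε = l - r, a value at most r would be at distance at least ε from l.
eventually-above : ∀ a l {r} → ConvergesTo a l → r ℚ.< l → ∃[ N ] ∀ s → s ≥ N → r ℚ.< a s
eventually-above a l {r} conv r<l with conv (l ℚ.- r) (p<q⇒0<q-p r<l)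
... | N , close = N , λ s s≥N → ℚ.≰⇒> λ as≤r → ℚ.<-irrefl refl (begin-strict
  l ℚ.- r                 ≤⟨ ℚ.+-monoʳ-≤ l (ℚ.neg-antimono-≤ as≤r) ⟩
  l ℚ.- a s               ≤⟨ p≤∣p∣ _ ⟩
  ℚ.∣ l ℚ.- a s ∣         ≡⟨ cong ℚ.∣_∣ (⁻¹-anti-homo-// (a s) l) ⟨
  ℚ.∣ ℚ.- (a s ℚ.- l) ∣   ≡⟨ ℚ.∣-p∣≡∣p∣ (a s ℚ.- l) ⟩
  ℚ.∣ a s ℚ.- l ∣         <⟨ close s s≥N ⟩
  l ℚ.- r                 ∎)
  where
  open ℚ.≤-Reasoning
  open import Algebra.Properties.Group ℚ.+-0-group using (⁻¹-anti-homo-//)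

eventually-below : ∀ a l {r} → ConvergesTo a l → l ℚ.< r → ∃[ N ] ∀ s → s ≥ N → a s ℚ.< r
eventually-below a l {r} conv l<r with conv (r ℚ.- l) (p<q⇒0<q-p l<r)
... | N , close = N , λ s s≥N → ℚ.≰⇒> λ r≤as → ℚ.<-irrefl refl (begin-strict
  r ℚ.- l                 ≤⟨ ℚ.+-monoˡ-≤ (ℚ.- l) r≤as ⟩
  a s ℚ.- l               ≤⟨ p≤∣p∣ _ ⟩
  ℚ.∣ a s ℚ.- l ∣         <⟨ close s s≥N ⟩
  r ℚ.- l                 ∎)
  where open ℚ.≤-Reasoning

-- A drop cannot lie within the rising phase, so t has reached the switch `s₀`, from which on the
-- sequence only falls.
ΣSeq₂-falls : ∀ {a s t} → ΣSeq 2 a → s ≤ t → a t ℚ.< a s → ∀ u → t ≤ u → a u ℚ.≤ a t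
ΣSeq₂-falls {a} {s} {t} (Σ-step s₀ up (Π-base down)) s≤t at<as u t≤u with t <? s₀
... | yes t<s₀ = ⊥-elim (ℚ.<-irrefl refl (ℚ.<-≤-trans at<as (up s t s≤t t<s₀)))
... | no  t≮s₀ = subst₂ (λ i j → a i ℚ.≤ a j)
  (m+[n∸m]≡n (≤-trans s₀≤t t≤u)) (m+[n∸m]≡n s₀≤t)
  (down (t ∸ s₀) (u ∸ s₀) (∸-monoˡ-≤ s₀ t≤u))
  where s₀≤t = ≮⇒≥ t≮s₀
-- A further switch would need an inhabitant of `ΣSeq 0`.
ΣSeq₂-falls (Σ-step _ _ (Π-step _ _ ()))

-- Complexity

1+n≤2^n : ∀ n → 1 + n ≤ 2 ^ n
1+n≤2^n zero    = s≤s z≤n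
1+n≤2^n (suc n) = begin
  2 + n           ≤⟨ s≤s (m≤m+n (1 + n) (n + 0)) ⟩
  2 + (n + (n + 0)) ≡⟨ *-suc 2 n ⟨
  2 * (1 + n)     ≤⟨ *-monoʳ-≤ 2 (1+n≤2^n n) ⟩
  2 ^ suc n       ∎
  where open ≤-Reasoning

-- The final comparison: with k + 1 = 2 ^ (C + 4), the left side bounds the complexity of the pair
-- found from k. The summand 4 supplies the factor 16, and 16 (1 + C) exceeds 3 C + 8.
2[C+4]+C<2^[C+4] : ∀ C → 2 * (C + 4) + C < 2 ^ (C + 4)
2[C+4]+C<2^[C+4] C = begin-strict
  2 * (C + 4) + C                       <⟨ m≤m+n _ (7 + 13 * C) ⟩
  suc (2 * (C + 4) + C) + (7 + 13 * C)  ≡⟨ arith C ⟩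
  (1 + C) * 16                          ≤⟨ *-monoˡ-≤ 16 (1+n≤2^n C) ⟩
  2 ^ C * 16                            ≡⟨ ^-distribˡ-+-* 2 C 4 ⟨
  2 ^ (C + 4)                           ∎
  where
  open ≤-Reasoning
  arith : ∀ C → suc (2 * (C + 4) + C) + (7 + 13 * C) ≡ (1 + C) * 16
  arith = solve-∀

module _ {U : Machine} (univ : IsUniversal U) {K : Str → Str → ℕ} (isK : IsComplexity U K) where
  open IsUniversal univ
  open IsComplexity isK

  opaque
    -- The program is `ρ` followed by the self-delimited w, whose unary header causes the factor 2.
    -- As `C` depends on `e` only, w = 0 gives a constant bound.
    K-upper : (e : Rec 2) → ∃[ C ] ∀ w b x → e [ w ∷ b ∷ [] ]⇓ x →
              K (decode x) (decode b) ≤ 2 * length (decode w) + C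
    K-upper e with universal (onSelfDelimited e) (onSelfDelimited-prefixFree e)
    ... | ρ , sim = 1 + length ρ , bound
      where
      open ≤-Reasoning
      arith : ∀ r l → r + (2 * l + 1) ≡ 2 * l + (1 + r)
      arith = solve-∀
      bound : ∀ w b x → e [ w ∷ b ∷ [] ]⇓ x → K (decode x) (decode b) ≤ 2 * length (decode w) + (1 + length ρ)
      bound w b x d = begin
        K (decode x) (decode b)
          ≤⟨ minimal _ _ (ρ ++ p) (Equivalence.to (sim p (decode b) (decode x))
               (onSelfDelimited⇓ e (decode w) _
                 (subst₂ (e [_]⇓_) (cong₂ (λ i j → i ∷ j ∷ []) (sym (codeStr-decode w)) (sym (codeStr-decode b)))
                   (sym (codeStr-decode x)) d))) ⟩
        length (ρ ++ p)                         ≡⟨ length-++ ρ ⟩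
        length ρ + length p                     ≡⟨ cong (λ l → length ρ + l) (length-selfDelimit (decode w)) ⟩
        length ρ + (2 * length (decode w) + 1)  ≡⟨ arith (length ρ) (length (decode w)) ⟩
        2 * length (decode w) + (1 + length ρ)  ∎
        where
        p : Str
        p = selfDelimit (decode w)

  -- Otherwise the empty program is defined on y, and by prefix-freeness it is
  -- the only one, so x is the only possible output.
  K>0 : ∀ x y → 1 ≤ K x y
  K>0 x y with attained x y | attained (true ∷ x) y
  ... | p@(_ ∷ _) , _ , len | _           = subst (1 ≤_) len (s≤s z≤n)
  ... | []        , d , len | q , d′ , _ with refl ← prefixFree y [] q x (true ∷ x) d d′ [] =
    ⊥-elim (m≢1+n+m (length x) (cong length (codeStr-injective x (true ∷ x) (⇓-deterministic d d′))))

  opaque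
    -- There are fewer than 2 ^ m programs of length below m.
    incompressible : ∀ m base y → ∃[ x ] base ≤ x × x < base + 2 ^ m × m ≤ K (decode x) y
    incompressible m base y with Fin.any? {n = 2 ^ m} (λ i → m ≤? K (decode (base + toℕ i)) y)
    ... | yes (i , m≤K) = base + toℕ i , m≤m+n base _ , +-monoʳ-< base (Fin.toℕ<n i) , m≤K
    ... | no none = ⊥-elim (collide (Fin.pigeonhole (≤-reflexive 1+pred≡) programIndex))
      where
      1+pred≡ : suc (pred (2 ^ m)) ≡ 2 ^ m
      1+pred≡ = suc-pred (2 ^ m) {{m^n≢0 2 m}}

      output program : Fin (2 ^ m) → Str
      output i = decode (base + toℕ i)
      program i = proj₁ (attained (output i) y)

      run : ∀ i → U ⟨ program i ∣ y ⟩↦ output i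
      run i = proj₁ (proj₂ (attained (output i) y))

      program-length : ∀ i → length (program i) < m
      program-length i = subst (_< m) (sym (proj₂ (proj₂ (attained (output i) y))))
        (≰⇒> λ m≤K → none (i , m≤K))

      -- The codes of strings shorter than m end at 2 ^ m - 2, so they number one fewer than the
      -- candidates.
      program-bound : ∀ i → codeStr (program i) < pred (2 ^ m)
      program-bound i = s<s⁻¹ (begin-strict
        1 + codeStr (program i)         <⟨ 1+codeStr<2^[1+length] (program i) ⟩
        2 ^ (1 + length (program i))    ≤⟨ ^-monoʳ-≤ 2 (program-length i) ⟩
        2 ^ m                           ≡⟨ 1+pred≡ ⟨
        suc (pred (2 ^ m))              ∎)
        where open ≤-Reasoning

      programIndex : Fin (2 ^ m) → Fin (pred (2 ^ m))
      programIndex i = fromℕ< (program-bound i)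

      toℕ-programIndex : ∀ i → toℕ (programIndex i) ≡ codeStr (program i)
      toℕ-programIndex i = Fin.toℕ-fromℕ< (program-bound i)

      collide : ¬ (∃[ i ] ∃[ j ] (toℕ i < toℕ j) × programIndex i ≡ programIndex j)
      collide (i , j , i<j , eq) = <⇒≢ i<j (+-cancelˡ-≡ base _ _ (begin
        base + toℕ i          ≡⟨ codeStr-decode (base + toℕ i) ⟨
        codeStr (output i)    ≡⟨ ⇓-deterministic (run i) (subst (λ p → U [ p ∷ codeStr y ∷ [] ]⇓ codeStr (output j)) (sym same) (run j)) ⟩
        codeStr (output j)    ≡⟨ codeStr-decode (base + toℕ j) ⟩
        base + toℕ j          ∎))
        where
        open ≡-Reasoning
        same : codeStr (program i) ≡ codeStr (program j)
        same = trans (sym (toℕ-programIndex i)) (trans (cong toℕ eq) (toℕ-programIndex j))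

  -- The normalised distance on codes, and pairs that are far apart

  E′ Kmax : ℕ → ℕ → ℕ
  E′ x y = E univ isK (decode x) (decode y)
  Kmax x y = K (decode x) [] ⊔ K (decode y) []

  E′>0 : ∀ x y → 1 ≤ E′ x y
  E′>0 x y = ≤-trans (K>0 (decode x) (decode y)) (m≤m⊔n (K (decode x) (decode y)) _)

  nid : ℕ → ℕ → ℚ
  nid x y = NID univ isK (decode x , decode y)

  nid-above : ∀ k x y → Kmax x y < E′ x y * suc k → reciprocal k ℚ.< nid x y
  nid-above k x y = reciprocal<fraction k (E′ x y) (Kmax x y)
    {{≢-nonZero (K≢0 univ isK (decode x) (decode y))}}

  nid-below : ∀ k x y → E′ x y * suc k < Kmax x y → nid x y ℚ.< reciprocal k
  nid-below k x y = fraction<reciprocal k (E′ x y) (Kmax x y)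
    {{≢-nonZero (K≢0 univ isK (decode x) (decode y))}}

  -- As E is at least 1, the value exceeds 1 / (Kmax + 1). Positivity makes the approximation
  -- eventually positive, as `lowTest-complete` demands.
  nid-positive : ∀ x y → 0ℚ ℚ.< nid x y
  nid-positive x y = ℚ.<-trans (0<reciprocal k) (nid-above k x y
    (≤-trans (≤-reflexive (sym (*-identityˡ (suc k)))) (*-monoˡ-≤ (suc k) (E′>0 x y))))
    where k = Kmax x y

  identityᵣ : Recursive {2} (λ xs → lookup xs zero)
  identityᵣ = var zero

  -- Choose y incompressible in the block of 2 ^ m numbers from 2 ^ m, then x incompressible given y
  -- in the block of that size from y². Then E ≥ m, whereas x and y have length at most 2 m + 1,
  -- hence complexity at most 4 m + 2 + A < 7 m. This yields the threshold 1/7.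
  far-pair : ∀ k → ∃[ y ] ∃[ b ] b ≤ y × k ≤ K (decode y) [] ×
             reciprocal 6 ℚ.< nid (y * y + b) y
  far-pair k =
    let A , K≤A = K-upper (code identityᵣ)
        -- At least 2 + A to absorb the additive constants, and at least k for the complexity of y.
        m = 2 + (A + k)
        y , 2^m≤y , y<2^m+2^m , m≤Ky = incompressible m (2 ^ m) []
        x , y²≤x , x<y²+2^m , m≤Kx∣y = incompressible m (y * y) (decode y)
        b≤y , far = bounds A m (+-monoʳ-≤ 2 (m≤m+n A k)) K≤A 2^m≤y y<2^m+2^m x<y²+2^m m≤Kx∣y
    in y , x ∸ y * y , b≤y , ≤-trans (≤-trans (m≤n+m k A) (m≤n+m _ 2)) m≤Ky ,
       subst (λ x → reciprocal 6 ℚ.< nid x y) (sym (m+[n∸m]≡n y²≤x))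
         (nid-above 6 x y far)
    where
    bounds : ∀ {x y} A m → 2 + A ≤ m →
      (∀ w b x → code identityᵣ [ w ∷ b ∷ [] ]⇓ x →
        K (decode x) (decode b) ≤ 2 * length (decode w) + A) →
      2 ^ m ≤ y → y < 2 ^ m + 2 ^ m → x < y * y + 2 ^ m → m ≤ K (decode x) (decode y) →
      x ∸ y * y ≤ y × Kmax x y < E′ x y * 7
    bounds {x} {y} A m 2+A≤m K≤A 2^m≤y y<2^m+2^m x<y²+2^m m≤Kx∣y = b≤y , (begin-strict
        Kmax x y                ≤⟨ ⊔-lub K≤x K≤y ⟩
        2 * (m + suc m) + A     <⟨ slack ⟩
        m * 7                   ≤⟨ *-monoˡ-≤ 7 (≤-trans m≤Kx∣y (m≤m⊔n (K (decode x) (decode y)) _)) ⟩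
        E′ x y * 7              ∎)
      where
      open ≤-Reasoning
      b≤y : x ∸ y * y ≤ y
      b≤y = begin
        x ∸ y * y               ≤⟨ ∸-monoˡ-≤ (y * y) (<⇒≤ x<y²+2^m) ⟩
        y * y + 2 ^ m ∸ y * y   ≡⟨ m+n∸m≡n (y * y) (2 ^ m) ⟩
        2 ^ m                   ≤⟨ 2^m≤y ⟩
        y                       ∎
      1+y≤2^[1+m] : 1 + y ≤ 2 ^ suc m
      1+y≤2^[1+m] = subst (λ p → y < 2 ^ m + p) (sym (+-identityʳ (2 ^ m))) y<2^m+2^m
      square : ∀ y → 1 + (y * y + y) + y ≡ (1 + y) * (1 + y)
      square = solve-∀
      1+x<2^[2+2m] : 1 + x < 2 ^ (suc m + suc m)
      1+x<2^[2+2m] = begin-strict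
        1 + x                     ≤⟨ x<y²+2^m ⟩
        y * y + 2 ^ m             ≤⟨ +-monoʳ-≤ (y * y) 2^m≤y ⟩
        y * y + y                 <⟨ m≤m+n (1 + (y * y + y)) y ⟩
        1 + (y * y + y) + y       ≡⟨ square y ⟩
        (1 + y) * (1 + y)         ≤⟨ *-mono-≤ 1+y≤2^[1+m] 1+y≤2^[1+m] ⟩
        2 ^ suc m * 2 ^ suc m     ≡⟨ ^-distribˡ-+-* 2 (suc m) (suc m) ⟨
        2 ^ (suc m + suc m)       ∎
      K≤x : K (decode x) [] ≤ 2 * (m + suc m) + A
      -- The identity machine prints x from x itself; the condition 0 decodes to the empty string.
      K≤x = ≤-trans (K≤A x 0 x (correct identityᵣ _))
        (+-monoˡ-≤ A (*-monoʳ-≤ 2 (length≤ (m + suc m) 1+x<2^[2+2m])))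
      K≤y : K (decode y) [] ≤ 2 * (m + suc m) + A
      K≤y = ≤-trans (K≤A y 0 y (correct identityᵣ _))
        (+-monoˡ-≤ A (*-monoʳ-≤ 2 (length≤ (m + suc m) (begin-strict
          1 + y               ≤⟨ 1+y≤2^[1+m] ⟩
          2 ^ suc m           <⟨ ^-monoʳ-< 2 (s≤s (s≤s z≤n)) (m<m+n (suc m) (s≤s z≤n)) ⟩
          2 ^ (suc m + suc m) ∎))))
      slack : 2 * (m + suc m) + A < m * 7
      slack = begin-strict
        2 * (m + suc m) + A             ≡⟨ split m A ⟩
        m * 4 + (2 + A)                 ≤⟨ +-monoʳ-≤ (m * 4) 2+A≤m ⟩
        m * 4 + m                       <⟨ m<m+n (m * 4 + m) (≤-trans (s≤s z≤n) 2+A≤m) ⟩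
        m * 4 + m + m                   ≤⟨ m≤m+n (m * 4 + m + m) m ⟩
        m * 4 + m + m + m               ≡⟨ merge m ⟩
        m * 7                           ∎
        where
        split : ∀ m A → 2 * (m + suc m) + A ≡ m * 4 + (2 + A)
        split = solve-∀
        merge : ∀ m → m * 4 + m + m + m ≡ m * 7
        merge = solve-∀

  -- Refutation of a Σ₂-approximation

  module _ {f : Str × Str → ℕ → ℚ} (approx : IsApproximation f (NID univ isK))
           (shape : ∀ z → ΣSeq 2 (f z)) where

    value : ℕ → ℕ → ℕ → ℚ
    value x y s = f (decode x , decode y) s

    numeratorᵣ : Recursive {3} (λ { (x ∷ y ∷ s ∷ []) → codeℤ (↥ value x y s) })
    numeratorᵣ with proj₁ approx
    ... | num , _ , spec = num computing λ { (x ∷ y ∷ s ∷ []) →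
      subst₂ (λ a b → num [ a ∷ b ∷ s ∷ [] ]⇓ codeℤ (↥ value x y s)) (codeStr-decode x) (codeStr-decode y)
        (proj₁ (spec (decode x) (decode y) s)) }

    denominatorᵣ : Recursive {3} (λ { (x ∷ y ∷ s ∷ []) → ↧ₙ value x y s })
    denominatorᵣ with proj₁ approx
    ... | _ , den , spec = den computing λ { (x ∷ y ∷ s ∷ []) →
      subst₂ (λ a b → den [ a ∷ b ∷ s ∷ [] ]⇓ ↧ₙ value x y s) (codeStr-decode x) (codeStr-decode y)
        (proj₂ (spec (decode x) (decode y) s)) }

    high : ℕ → ℕ → ℕ → ℕ
    high x y s = highTest (codeℤ (↥ value x y s)) (↧ₙ value x y s)

    low : ℕ → ℕ → ℕ → ℕ → ℕ
    low k x y s = lowTest (suc k) (codeℤ (↥ value x y s)) (↧ₙ value x y s)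

    highᵣ : ∀ {n} {x y s : Vec ℕ n → ℕ} → Recursive x → Recursive y → Recursive s →
            Recursive (λ xs → high (x xs) (y xs) (s xs))
    highᵣ X Y S = highTestᵣ num den
      where
      num = compose₃ numeratorᵣ X Y S
      den = compose₃ denominatorᵣ X Y S

    lowᵣ : ∀ {n} {k x y s : Vec ℕ n → ℕ} → Recursive k → Recursive x → Recursive y → Recursive s →
           Recursive (λ xs → low (k xs) (x xs) (y xs) (s xs))
    lowᵣ K X Y S = lowTestᵣ (suc′ K) num den
      where
      num = compose₃ numeratorᵣ X Y S
      den = compose₃ denominatorᵣ X Y S

    -- The summand `b ∸ y` enforces b ≤ y, which keeps y recoverable from y² + b as its root.
    partnerTest : ℕ → ℕ → ℕ → ℕ
    partnerTest y b s = (b ∸ y) + high (y * y + b) y s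

    partnerTestᵣ : Recursive {3} (λ xs → let w = lookup xs zero; y = lookup xs (suc (suc zero)) in
                                  partnerTest y (fst w) (snd w))
    partnerTestᵣ = (fstᵣ w ⊖ y) ⊕ highᵣ (y ⊗ y ⊕ fstᵣ w) y (sndᵣ w)
      where
      w = var zero
      y = var (suc (suc zero))

    partnerᵣ : Recursive {3} (λ xs → let w = lookup xs zero; y = lookup xs (suc (suc zero)) in y * y + fst w)
    partnerᵣ = y ⊗ y ⊕ fstᵣ (var zero)
      where y = var (suc (suc zero))

    -- Here y is the condition, so a run on program 0, the empty string, bounds K(x | y) by a
    -- constant.
    partnerMachine : Rec 2
    partnerMachine = search partnerTestᵣ partnerᵣ

    -- The search stops at the first pair that passes, possibly not the given one, so all that is
    -- kept about `b′` and `s′` is the test.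
    partnerMachine⇓ : ∀ {y b s} → partnerTest y b s ≡ 0 →
      ∃[ b′ ] ∃[ s′ ] partnerTest y b′ s′ ≡ 0 × partnerMachine [ 0 ∷ y ∷ [] ]⇓ y * y + b′
    partnerMachine⇓ {y} {b} {s} found =
      let w , test , d = search⇓ partnerTestᵣ partnerᵣ 0 y (pair b s)
            (subst₂ (λ b s → partnerTest y b s ≡ 0) (sym (fst-pair b s)) (sym (snd-pair b s)) found)
      in fst w , snd w , test , d

    -- The first summand enforces s < t: a zero records a value of at least 1/7 followed by one
    -- below 1 / (k + 1).
    dropTest : ℕ → ℕ → ℕ → ℕ → ℕ → ℕ
    dropTest k x y s t = (suc s ∸ t) + (high x y s + low k x y t)

    -- Packs the four unknowns into one number, over which `mini` can search.
    packedDropTest : ℕ → ℕ → ℕ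
    packedDropTest k w = dropTest k (fst (fst w)) (snd (fst w)) (fst (snd w)) (snd (snd w))

    packedDropTest-pair : ∀ {k x y s t} → dropTest k x y s t ≡ 0 →
                          packedDropTest k (pair (pair x y) (pair s t)) ≡ 0
    packedDropTest-pair {k} {x} {y} {s} {t} found =
      subst₂ (λ u v → dropTest k (fst u) (snd u) (fst v) (snd v) ≡ 0)
        (sym (fst-pair (pair x y) (pair s t))) (sym (snd-pair (pair x y) (pair s t)))
        (subst₂ (λ x y → dropTest k x y (fst (pair s t)) (snd (pair s t)) ≡ 0)
          (sym (fst-pair x y)) (sym (snd-pair x y))
          (subst₂ (λ s t → dropTest k x y s t ≡ 0) (sym (fst-pair s t)) (sym (snd-pair s t)) found))

    packedDropTestᵣ : Recursive {3} (λ xs → packedDropTest (lookup xs (suc zero)) (lookup xs zero))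
    packedDropTestᵣ = (suc′ s ⊖ t) ⊕ (highᵣ x y s ⊕ lowᵣ (var (suc zero)) x y t)
      where
      w = var zero
      x = fstᵣ (fstᵣ w)
      y = sndᵣ (fstᵣ w)
      s = fstᵣ (sndᵣ w)
      t = sndᵣ (sndᵣ w)

    firstᵣ : Recursive {3} (λ xs → fst (fst (lookup xs zero)))
    firstᵣ = fstᵣ (fstᵣ (var zero))

    secondᵣ : Recursive {3} (λ xs → snd (fst (lookup xs zero)))
    secondᵣ = sndᵣ (fstᵣ (var zero))

    -- Both run the same search, so they output the two coordinates of one pair, each from the
    -- program k alone.
    dropMachine₁ dropMachine₂ : Rec 2
    dropMachine₁ = search packedDropTestᵣ firstᵣ
    dropMachine₂ = search packedDropTestᵣ secondᵣ

    dropMachines⇓ : ∀ {k x y s t} → dropTest k x y s t ≡ 0 →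
      ∃[ x′ ] ∃[ y′ ] ∃[ s′ ] ∃[ t′ ] dropTest k x′ y′ s′ t′ ≡ 0
        × dropMachine₁ [ k ∷ 0 ∷ [] ]⇓ x′ × dropMachine₂ [ k ∷ 0 ∷ [] ]⇓ y′
    dropMachines⇓ {k} {x} {y} {s} {t} found =
      -- A single call of `minimise` makes `w` common to both outputs.
      let w , test , d = minimise packedDropTestᵣ (k ∷ 0 ∷ []) (pair (pair x y) (pair s t))
            (packedDropTest-pair {k} {x} {y} {s} {t} found)
      in fst (fst w) , snd (fst w) , fst (snd w) , snd (snd w) , test
        , ⇓comp (d ∷ ⇓proj zero ∷ ⇓proj (suc zero) ∷ []) (correct firstᵣ (w ∷ k ∷ 0 ∷ []))
        , ⇓comp (d ∷ ⇓proj zero ∷ ⇓proj (suc zero) ∷ []) (correct secondᵣ (w ∷ k ∷ 0 ∷ []))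

    converges : ∀ x y → ConvergesTo (value x y) (nid x y)
    converges x y = proj₂ approx (decode x , decode y)

    -- The partner x of y is computable from y, and y is the root of x, so E(x , y)
    -- is bounded, however complex y is.
    close-pair : ∀ k → ∃[ x ] ∃[ y ] ∃[ s ] high x y s ≡ 0 ×
                 nid x y ℚ.< reciprocal k
    close-pair k =
      let B , K≤B = K-upper partnerMachine
          C , K≤C = K-upper (code R)
          -- E will be at most B + C, so this complexity of y makes E (k + 1) smaller than K(y).
          y , b , b≤y , complex , far = far-pair (suc ((B + C) * suc k))
          b′ , s , test , found = partner-found y b b≤y far
      in conclude B C y b′ s K≤B K≤C complex test found
      where
      open ≤-Reasoning
      R : Recursive {2} (λ xs → root (lookup xs (suc zero)))
      R = rootᵣ (var (suc zero))
      root⇓ : ∀ {y b} → b ≤ y → code R [ 0 ∷ y * y + b ∷ [] ]⇓ y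
      root⇓ {y} {b} b≤y = subst (code R [ 0 ∷ y * y + b ∷ [] ]⇓_)
        (root-unique y b≤y) (correct R (0 ∷ y * y + b ∷ []))
      partner-found : ∀ y b → b ≤ y → reciprocal 6 ℚ.< nid (y * y + b) y →
        ∃[ b′ ] ∃[ s′ ] partnerTest y b′ s′ ≡ 0 × partnerMachine [ 0 ∷ y ∷ [] ]⇓ y * y + b′
      partner-found y b b≤y far =
        let N , above = eventually-above (value (y * y + b) y) (nid (y * y + b) y) (converges (y * y + b) y) far
        in partnerMachine⇓ {y} {b} {N} (cong₂ _+_ (m≤n⇒m∸n≡0 b≤y)
             (highTest-complete (value (y * y + b) y N) (ℚ.<⇒≤ (above N ≤-refl))))
      bound : ∀ {x y B C} → K (decode x) (decode y) ≤ B → K (decode y) (decode x) ≤ C →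
              (B + C) * suc k < K (decode y) [] →
              E′ x y * suc k < Kmax x y
      bound {x} {y} {B} {C} K≤B K≤C complex = begin-strict
        E′ x y * suc k
          ≤⟨ *-monoˡ-≤ (suc k) (⊔-lub (≤-trans K≤B (m≤m+n B C)) (≤-trans K≤C (m≤n+m C B))) ⟩
        (B + C) * suc k                     <⟨ complex ⟩
        K (decode y) []                     ≤⟨ m≤n⊔m (K (decode x) []) (K (decode y) []) ⟩
        Kmax x y   ∎

      conclude : ∀ B C y b s →
        (∀ w b x → partnerMachine [ w ∷ b ∷ [] ]⇓ x → K (decode x) (decode b) ≤ 2 * length (decode w) + B) →
        (∀ w b x → code R [ w ∷ b ∷ [] ]⇓ x → K (decode x) (decode b) ≤ 2 * length (decode w) + C) →
        (B + C) * suc k < K (decode y) [] → partnerTest y b s ≡ 0 →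
        partnerMachine [ 0 ∷ y ∷ [] ]⇓ y * y + b →
        ∃[ x ] ∃[ y ] ∃[ s ] high x y s ≡ 0 × nid x y ℚ.< reciprocal k
      conclude B C y b s K≤B K≤C complex test found =
        y * y + b , y , s , m+n≡0⇒n≡0 (b ∸ y) test ,
        -- Both programs are 0, of length zero, which leaves the bare constants B and C.
        nid-below k (y * y + b) y (bound {y * y + b} {y} {B} {C} (K≤B 0 y (y * y + b) found)
          (K≤C 0 (y * y + b) y (root⇓ (m∸n≡0⇒m≤n (m+n≡0⇒m≡0 (b ∸ y) test)))) complex)

    dropTest-succeeds : ∀ k → ∃[ x ] ∃[ y ] ∃[ s ] ∃[ t ] dropTest k x y s t ≡ 0
    dropTest-succeeds k =
      let x , y , s , isHigh , close = close-pair k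
      in x , y , s , drop x y s isHigh close
      where
      drop : ∀ x y s → high x y s ≡ 0 → nid x y ℚ.< reciprocal k → ∃[ t ] dropTest k x y s t ≡ 0
      drop x y s isHigh close =
        let N , positive = eventually-above (value x y) (nid x y) (converges x y) (nid-positive x y)
            N′ , small = eventually-below (value x y) (nid x y) (converges x y) close
            -- Later than s, and late enough for the approximation to be both positive and below 1 /
            -- (k + 1).
            t = suc s ⊔ (N ⊔ N′)
        in t , cong₂ _+_ (m≤n⇒m∸n≡0 (m≤m⊔n (suc s) (N ⊔ N′))) (cong₂ _+_ isHigh
             (lowTest-complete k (value x y t)
               (positive t (≤-trans (m≤m⊔n N N′) (m≤n⊔m (suc s) (N ⊔ N′))))
               (small t (≤-trans (m≤n⊔m N N′) (m≤n⊔m (suc s) (N ⊔ N′))))))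

    -- The value falls from s to t, since 6 ≤ k makes 1 / (k + 1) at most 1/7. A limit above 1 / (k
    -- + 1) would force a later rise, against `ΣSeq₂-falls`.
    dropTest-impossible : ∀ {k x y s t} → 6 ≤ k → dropTest k x y s t ≡ 0 →
                          ¬ (reciprocal k ℚ.< nid x y)
    dropTest-impossible {k} {x} {y} {s} {t} 6≤k test k⁻¹<nid =
      let N , rise = eventually-above (value x y) (nid x y) (converges x y) k⁻¹<nid
          u = t ⊔ N
      in ℚ.<-irrefl refl (begin-strict
        value x y u    ≤⟨ ΣSeq₂-falls (shape (decode x , decode y)) (<⇒≤ s<t) fall u (m≤m⊔n t N) ⟩
        value x y t    <⟨ isLow ⟩
        reciprocal k   <⟨ rise u (m≤n⊔m t N) ⟩
        value x y u    ∎)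
      where
      open ℚ.≤-Reasoning
      s<t : s < t
      s<t = m∸n≡0⇒m≤n (m+n≡0⇒m≡0 (suc s ∸ t) test)
      isHigh×isLow : high x y s + low k x y t ≡ 0
      isHigh×isLow = m+n≡0⇒n≡0 (suc s ∸ t) test
      isLow : value x y t ℚ.< reciprocal k
      isLow = lowTest-sound k (value x y t) (m+n≡0⇒n≡0 (high x y s) isHigh×isLow)
      fall : value x y t ℚ.< value x y s
      fall = begin-strict
        value x y t    <⟨ isLow ⟩
        reciprocal k   ≤⟨ reciprocal-antitone 6≤k ⟩
        reciprocal 6   ≤⟨ highTest-sound (value x y s) (m+n≡0⇒m≡0 (high x y s) isHigh×isLow) ⟩
        value x y s    ∎

    impossible : ⊥
    impossible =
      let A , K≤A = K-upper dropMachine₁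
          B , K≤B = K-upper dropMachine₂
          -- The string of this k has length at most A + B + 4, so the pair found has complexity at
          -- most 2 (A + B + 4) + A + B, which is less than k + 1.
          k = pred (2 ^ (A + B + 4))
          x₀ , y₀ , s₀ , t₀ , found = dropTest-succeeds k
          x , y , s , t , test , x⇓ , y⇓ = dropMachines⇓ {k} {x₀} {y₀} {s₀} {t₀} found
      in conclude A B k x y s t (suc-pred (2 ^ (A + B + 4)) {{m^n≢0 2 (A + B + 4)}})
           (K≤A k 0 x x⇓) (K≤B k 0 y y⇓) test
      where
      6≤ : ∀ {k} C → suc k ≡ 2 ^ (C + 4) → 6 ≤ k
      6≤ C 1+k≡ = s≤s⁻¹ (subst (7 ≤_) (sym 1+k≡)
        (≤-trans (m≤m+n 7 9) (^-monoʳ-≤ 2 (m≤n+m 4 C))))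
      bound : ∀ {x y k} A B → suc k ≡ 2 ^ (A + B + 4) →
        K (decode x) [] ≤ 2 * length (decode k) + A → K (decode y) [] ≤ 2 * length (decode k) + B →
        Kmax x y < E′ x y * suc k
      bound {x} {y} {k} A B 1+k≡ K≤A K≤B = begin-strict
        Kmax x y
          ≤⟨ ⊔-lub (≤-trans K≤A (+-mono-≤ (*-monoʳ-≤ 2 k-length) (m≤m+n A B)))
                   (≤-trans K≤B (+-mono-≤ (*-monoʳ-≤ 2 k-length) (m≤n+m B A))) ⟩
        2 * (A + B + 4) + (A + B)  <⟨ 2[C+4]+C<2^[C+4] (A + B) ⟩
        2 ^ (A + B + 4)            ≡⟨ 1+k≡ ⟨
        suc k                      ≡⟨ *-identityˡ (suc k) ⟨
        1 * suc k                  ≤⟨ *-monoˡ-≤ (suc k) (E′>0 x y) ⟩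
        E′ x y * suc k ∎
        where
        open ≤-Reasoning
        k-length : length (decode k) ≤ A + B + 4
        k-length = length≤ (A + B + 4) (subst (_< 2 ^ suc (A + B + 4)) (sym 1+k≡)
          (^-monoʳ-< 2 (s≤s (s≤s z≤n)) (n<1+n (A + B + 4))))

      conclude : ∀ A B k x y s t → suc k ≡ 2 ^ (A + B + 4) →
        K (decode x) [] ≤ 2 * length (decode k) + A → K (decode y) [] ≤ 2 * length (decode k) + B →
        dropTest k x y s t ≡ 0 → ⊥
      conclude A B k x y s t 1+k≡ K≤A K≤B test =
        dropTest-impossible {k} {x} {y} {s} {t} (6≤ (A + B) 1+k≡) test
          (nid-above k x y (bound {x} {y} {k} A B 1+k≡ K≤A K≤B))

mainTheorem7 : (U : Machine) (univ : IsUniversal U) (K : Str → Str → ℕ) (isK : IsComplexity U K) → NID univ isK ∉Σ[ 2 ]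
mainTheorem7 U univ K isK (f , approx , shape) = impossible univ isK approx shape
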